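{- Let $G$ be a connected graph with $\chi(G)=k\ge 3$. Let $\mathscr C_0=\{V_1,V_2,\dots,V_r\}$ be a Sudoku coloring of $G$ defined on an induced subgraph $G[S]$ for some $S\subset V(G)$, where $V_1,\dots,V_r$ are the (nonempty) color classes of $\mathscr C_0$. Then $r=k-1$ or $r=k$.
   Context: Graphs are finite, undirected and simple. Let $G=(V,E)$ be a connected graph with chromatic number $\chi(G)=k\ge 2$. For $S\subset V$, a partial coloring on $G[S]$ is a proper coloring $\mathscr C_0$ of the induced subgraph $G[S]$ with colors from $\{1,\dots,k\}$ (not all colors need be used); it may be written as the collection of its color classes. It is a Sudoku coloring of $G$ if there is exactly one proper $k$-coloring $V\to\{1,\dots,k\}$ of $G$ whose restriction to $S$ is $\mathscr C_0$. -}

module Defs where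

open import Data.Nat using (ℕ; _≤_)
open import Data.Fin using (Fin)
open import Data.Fin.Subset using (Subset; _∈_; Nonempty)
open import Data.Product using (Σ; ∃; ∃!; _×_; _,_; proj₁)
open import Function using (_∘_; _on_; _⇔_; Injective)
open import Level using (0ℓ)
open import Relation.Binary using (Rel; Decidable; Symmetric; Irreflexive)
open import Relation.Binary.Construct.Closure.ReflexiveTransitive using (Star)
open import Relation.Binary.PropositionalEquality using (_≡_; _≢_; _≗_; refl)

-- Simple graph on V; finite graphs are obtained by taking V = Fin n.
record Graph (V : Set) : Set₁ where
  field
    Adj     : Rel V 0ℓ
    adj?    : Decidable Adj
    symm    : Symmetric Adj
    irrefl  : Irreflexive _≡_ Adj

open Graph public

-- The graph with no vertices counts as connected here; its chromatic number
-- is 0, so it plays no role once χ(G) ≥ 1 is assumed.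
Connected : {V : Set} → Graph V → Set
Connected G = ∀ u v → Star (Adj G) u v

Proper : {V : Set} {k : ℕ} → Graph V → (V → Fin k) → Set
Proper G c = ∀ {u v} → Adj G u v → c u ≢ c v

Colorable : {V : Set} → Graph V → ℕ → Set
Colorable {V} G k = Σ (V → Fin k) (Proper G)

IsChromaticNumber : {V : Set} → Graph V → ℕ → Set
IsChromaticNumber G k = Colorable G k × (∀ j → Colorable G j → k ≤ j)

module _ {n : ℕ} where

  ⟦_⟧ : Subset n → Set
  ⟦ S ⟧ = ∃ λ v → v ∈ S

  induced : Graph (Fin n) → (S : Subset n) → Graph ⟦ S ⟧
  induced G S = record
    { Adj    = Adj G on proj₁
    ; adj?   = λ u v → adj? G (proj₁ u) (proj₁ v)
    ; symm   = symm G
    ; irrefl = λ { refl → irrefl G refl }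
    }

  -- Colorings are compared pointwise, so uniqueness is up to _≗_.
  record IsSudoku {k : ℕ} (G : Graph (Fin n)) (S : Subset n)
                  (c₀ : ⟦ S ⟧ → Fin k) : Set where
    field
      proper          : Proper (induced G S) c₀
      uniqueExtension : ∃! _≗_ λ (c : Fin n → Fin k) →
                          Proper G c × (c ∘ proj₁ ≗ c₀)

  IsColorClass : {k : ℕ} {S : Subset n} → (⟦ S ⟧ → Fin k) →
                 Fin k → Subset n → Set
  IsColorClass {S = S} c₀ a W =
    ∀ v → v ∈ W ⇔ Σ (v ∈ S) λ v∈S → c₀ (v , v∈S) ≡ a

  -- Vs lists each nonempty color class of c₀ exactly once.
  record AreColorClasses {k r : ℕ} {S : Subset n} (c₀ : ⟦ S ⟧ → Fin k)
                         (Vs : Fin r → Subset n) : Set where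
    field
      isClass  : ∀ i → ∃ λ a → IsColorClass c₀ a (Vs i)
      nonempty : ∀ i → Nonempty (Vs i)
      distinct : Injective _≡_ _≡_ Vs
      complete : ∀ a W → IsColorClass c₀ a W → Nonempty W →
                 ∃ λ i → Vs i ≡ W

{-# OPTIONS --safe #-}

-- Swapping two colours absent from c₀ maps an extension of c₀ to an extension of
-- c₀, so by uniqueness it fixes the Sudoku solution, which therefore uses neither
-- colour; this contradicts the minimality of k. Hence at most one colour is absent.

module Submission where

open import Defs
open import Data.Nat using (ℕ; suc; _≤_; _<_; _∸_)
open import Data.Nat.Properties using (m≤n⇒m<n∨m≡n; n≮n; <⇒≱)
open import Data.Fin using (Fin; zero; suc; punchOut)
open import Data.Fin.Properties
  using (_≟_; any?; ¬∀⟶∃¬; injective⇒≤; punchOut-injective)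
open import Data.Fin.Permutation.Components using (transpose; transpose-inverse)
open import Data.Fin.Subset using (Subset; _∈_)
open import Data.Fin.Subset.Properties using (_∈?_; ⊆-antisym)
open import Data.Product using (Σ; ∃; _,_; proj₁; proj₂)
open import Data.Sum using (_⊎_; inj₁; inj₂)
open import Data.Vec using (tabulate)
open import Data.Vec.Functional using (_∷_)
open import Data.Vec.Properties using (lookup∘tabulate; lookup⇒[]=; []=⇒lookup)
open import Function using (_∘_; _⇔_; mk⇔; Equivalence; Injective)
open import Relation.Binary.PropositionalEquality
  using (_≡_; _≢_; _≗_; refl; sym; trans; cong; subst)
open import Relation.Nullary using (¬_; yes; no; does; contradiction)
open import Relation.Nullary.Decidable using (dec-true; map′; _×-dec_; decidable-stable)
open import Relation.Unary using (Pred; Decidable)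
open import Level using (0ℓ)

module _ {n : ℕ} {P : Pred (Fin n) 0ℓ} where

  -- Turns a decidable color class into a `Subset`, the form that `complete` accepts.
  comprehension : Decidable P → ∃ λ (W : Subset n) → ∀ v → v ∈ W ⇔ P v
  comprehension P? = tabulate (does ∘ P?) , λ v → mk⇔ (to v) (from v)
    where
    to : ∀ v → v ∈ tabulate (does ∘ P?) → P v
    to v v∈W with P? v | trans (sym (lookup∘tabulate (does ∘ P?) v)) ([]=⇒lookup v∈W)
    ... | yes p | _  = p
    ... | no _  | ()

    from : ∀ v → P v → v ∈ tabulate (does ∘ P?)
    from v p = lookup⇒[]= v _ (trans (lookup∘tabulate (does ∘ P?) v) (dec-true (P? v) p))

-- Choosing a preimage of every value would inject `Fin k` into `Fin m`. Both quantifiers range over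
-- finite sets, so a missed value can be found by search.
<⇒notSurjective : ∀ {m k} → m < k → (f : Fin m → Fin k) → ∃ λ a → ∀ i → f i ≢ a
<⇒notSurjective {m} {k} m<k f =
  let a , a∉f = ¬∀⟶∃¬ k (λ a → ∃ λ i → f i ≡ a) (λ a → any? λ i → f i ≟ a)
                  (λ onto → <⇒≱ m<k (injective⇒≤ (section-injective onto)))
  in a , λ i fi≡a → a∉f (i , fi≡a)
  where
  section-injective : (onto : ∀ a → ∃ λ i → f i ≡ a) → Injective _≡_ _≡_ (proj₁ ∘ onto)
  section-injective onto {a} {b} eq =
    trans (sym (proj₂ (onto a))) (trans (cong f eq) (proj₂ (onto b)))

module _ {k : ℕ} (a b : Fin k) where

  transpose-injective : Injective _≡_ _≡_ (transpose a b)
  transpose-injective eq = trans (sym (transpose-inverse b a))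
    (trans (cong (transpose b a) eq) (transpose-inverse b a))

  transpose-fixes : ∀ {x} → x ≢ a → x ≢ b → transpose a b x ≡ x
  transpose-fixes {x} x≢a x≢b with x ≟ a
  ... | yes x≡a = contradiction x≡a x≢a
  ... | no _ with x ≟ b
  ...   | yes x≡b = contradiction x≡b x≢b
  ...   | no _    = refl

  transpose-moves : ∀ {x} → x ≡ a → transpose a b x ≡ b
  transpose-moves {x} x≡a with x ≟ a
  ... | yes _  = refl
  ... | no x≢a = contradiction x≡a x≢a

minimal⇒allColorsUsed : ∀ {V k} {G : Graph V} → (∀ j → Colorable G j → k ≤ j) →
                        {c : V → Fin k} → Proper G c →
                        ∀ a → ¬ (∀ v → c v ≢ a)
minimal⇒allColorsUsed {k = suc k} minimal proper a a∉c =
  n≮n k (minimal k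
    ( (λ v → punchOut (a∉c v ∘ sym))
    , λ {u} {v} uv eq → proper uv (punchOut-injective (a∉c u ∘ sym) (a∉c v ∘ sym) eq)))

module _ {n k : ℕ} {S : Subset n} {c₀ : ⟦ S ⟧ → Fin k} where

  sudoku⇒absentColorUnique : {G : Graph (Fin n)} → IsChromaticNumber G k → IsSudoku G S c₀ →
    ∀ {a b} → (∀ x → c₀ x ≢ a) → (∀ x → c₀ x ≢ b) → a ≡ b
  sudoku⇒absentColorUnique {G} (_ , minimal) sudoku {a} {b} a∉c₀ b∉c₀
    with c , (proper , extends) , unique ← IsSudoku.uniqueExtension sudoku
    = decidable-stable (a ≟ b) λ a≢b →
        minimal⇒allColorsUsed {G = G} minimal proper a λ v cv≡a →
          -- Since the swap fixes `c`, a vertex of color `a` would also have color `b`.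
          a≢b (trans (sym cv≡a) (trans (swap-fixes v) (transpose-moves a b cv≡a)))
    where
    swap-fixes : c ≗ transpose a b ∘ c
    swap-fixes = unique
      ( (λ uv eq → proper uv (transpose-injective a b eq))
      , λ x → trans (cong (transpose a b) (extends x))
                    (transpose-fixes a b (a∉c₀ x) (b∉c₀ x)))

  module _ {c : Fin n → Fin k} (extends : c ∘ proj₁ ≗ c₀)
           {r : ℕ} {Vs : Fin r → Subset n} (classes : AreColorClasses c₀ Vs) where
    open AreColorClasses classes
    open Equivalence

    color : Fin r → Fin k
    color i = proj₁ (isClass i)

    -- A color determines its class as a set, so indices of equal color carry the same subset. This
    -- gives `r ≤ k`.
    color-injective : Injective _≡_ _≡_ color
    color-injective {i} {j} eq = distinct (⊆-antisym (incl i j eq) (incl j i (sym eq)))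
      where
      incl : ∀ i j → color i ≡ color j → ∀ {v} → v ∈ Vs i → v ∈ Vs j
      incl i j eq {v} v∈Vi with v∈S , c₀v≡ ← to (proj₂ (isClass i) v) v∈Vi =
        from (proj₂ (isClass j) v) (v∈S , trans c₀v≡ eq)

    -- The class of `x` contains `x`, so `complete` lists it at some `i`. The color that `isClass`
    -- records for `i` is given separately, hence the comparison at a vertex of `Vs i`.
    color-covers : ∀ x → ∃ λ i → color i ≡ c₀ x
    color-covers x@(v , v∈S) with comprehension class?
      where
      class? : Decidable λ u → Σ (u ∈ S) λ u∈S → c₀ (u , u∈S) ≡ c₀ x
      -- Testing `c u` avoids any choice of membership proof: `c` agrees with `c₀` for each of them.
      class? u = map′
        (λ (u∈S , cu≡) → u∈S , trans (sym (extends (u , u∈S))) cu≡)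
        (λ (u∈S , c₀u≡) → u∈S , trans (extends (u , u∈S)) c₀u≡)
        (u ∈? S ×-dec c u ≟ c₀ x)
    ... | W , isClassW
      with i , Vi≡W ← complete (c₀ x) W isClassW (v , from (isClassW v) (v∈S , refl))
      with u , u∈Vi ← nonempty i
      with u∈S , c₀u≡color ← to (proj₂ (isClass i) u) u∈Vi
      with u∈S′ , c₀u≡c₀x ← to (isClassW u) (subst (u ∈_) Vi≡W u∈Vi)
      -- The two proofs that `u` lies in `S` may differ; both values of `c₀` equal `c u`.
      = i , trans (sym c₀u≡color)
              (trans (sym (extends (u , u∈S))) (trans (extends (u , u∈S′)) c₀u≡c₀x))

    color-misses⇒absent : ∀ {a} → (∀ i → color i ≢ a) → ∀ x → c₀ x ≢ a
    color-misses⇒absent a∉color x c₀x≡a with i , eq ← color-covers x =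
      a∉color i (trans eq c₀x≡a)

mainTheorem13 : (n k : ℕ) (G : Graph (Fin n)) →
    Connected G →
    IsChromaticNumber G k →
    3 ≤ k →
    (S : Subset n) (c₀ : ⟦ S ⟧ → Fin k) →
    IsSudoku G S c₀ →
    (r : ℕ) (Vs : Fin r → Subset n) →
    AreColorClasses c₀ Vs →
    r ≡ k ∸ 1 ⊎ r ≡ k
mainTheorem13 n k G _ χ≡k _ S c₀ sudoku r Vs classes
  with c , (_ , extends) , _ ← IsSudoku.uniqueExtension sudoku
  with m≤n⇒m<n∨m≡n (injective⇒≤ (color-injective extends classes))
... | inj₂ r≡k = inj₂ r≡k
... | inj₁ r<k with m≤n⇒m<n∨m≡n r<k
...   | inj₂ 1+r≡k = inj₁ (cong (_∸ 1) 1+r≡k)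
...   | inj₁ 1+r<k
  with a , a∉ ← <⇒notSurjective r<k (color extends classes)
  -- Prepending `a` to the `r` class colors makes `b` a second absent color distinct from `a`; the
  -- list of `1 + r` colors is still shorter than `k`.
  with b , b∉ ← <⇒notSurjective 1+r<k (a ∷ color extends classes)
  = contradiction
      (sudoku⇒absentColorUnique χ≡k sudoku (absent a∉) (absent (b∉ ∘ suc)))
      (b∉ zero)
  where
  absent : ∀ {a} → (∀ i → color extends classes i ≢ a) → ∀ x → c₀ x ≢ a
  absent = color-misses⇒absent extends classes
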